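{- For $P \subseteq \mathbb{R}^2$, the function $\operatorname{opx}(n, P)$ is continuous in $n$ for $n > 0$.
   Context: Containment for subsets of the plane: for $P, S \subseteq \mathbb{R}^2$, let $X_P, Y_P$ be the sets of $x$-coordinates and $y$-coordinates of points of $P$, and $X_S, Y_S$ likewise for $S$. $S$ contains $P$ if there exist functions $f_X: X_P \to X_S$ and $f_Y: Y_P \to Y_S$ such that (1) $\frac{f_X(x_0)-f_X(x_1)}{x_0-x_1} \ge 1$ for all $x_0 > x_1$ in $X_P$; (2) $\frac{f_Y(y_0)-f_Y(y_1)}{y_0-y_1} \ge 1$ for all $y_0 > y_1$ in $Y_P$; (3) $(f_X(x), f_Y(y)) \in S$ for all $(x,y) \in P$. Otherwise $S$ is $P$-free. For real $n > 0$, $\operatorname{opx}(n,P)$ is the supremum of the Lebesgue measure $\mu_2(S)$ over all open $P$-free subsets $S \subseteq [0,n]^2$. -}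

module Defs where

open import Algebra.Bundles using (CommutativeRing)
open import Data.Fin.Base using (toℕ)
open import Data.Nat.Base using (ℕ; zero; suc)
open import Data.Product.Base using (Σ; ∃; ∃-syntax; _×_; _,_; proj₁; proj₂)
open import Data.Product.Relation.Binary.Pointwise.NonDependent using (Pointwise)
open import Data.Sum.Base using (_⊎_; inj₁; inj₂)
open import Function.Bundles using (Func)
open import Level using (0ℓ; Level)
open import Relation.Binary.Bundles using (Setoid)
open import Relation.Binary.Core using (Rel)
open import Relation.Binary.Definitions using (_Respects_; tri<; tri≈; tri>)
open import Relation.Binary.Structures using (IsStrictTotalOrder; IsTotalOrder)
open import Relation.Nullary.Negation.Core using (¬_; contradiction)
open import Relation.Unary using (Pred; _∪_)
import Algebra.Definitions as AlgebraDefinitions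
import Algebra.Properties.Group as GroupProperties
import Algebra.Properties.Monoid.Sum as MonoidSum
import Algebra.Properties.Ring as RingProperties
import Relation.Binary.Construct.On as On
import Relation.Binary.Construct.StrictToNonStrict as ToNonStrict

module Order {A : Set} (_≤_ : Rel A 0ℓ) where

  private variable ℓ : Level

  UpperBound LowerBound IsSupremum IsInfimum : Pred A ℓ → A → Set ℓ
  UpperBound X u = ∀ {x} → X x → x ≤ u
  LowerBound X l = ∀ {x} → X x → l ≤ x
  IsSupremum X s = UpperBound X s × (∀ u → UpperBound X u → s ≤ u)
  IsInfimum  X i = LowerBound X i × (∀ l → LowerBound X l → l ≤ i)

-- The real numbers, characterised up to isomorphism as a complete ordered
-- field.  There being no quotient types, equality is a setoid equality _≈_.
-- Completeness is required for predicates valued in Set₁ because opx is a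
-- supremum over subsets of the plane, which are themselves Set-valued
-- predicates.
record CompleteOrderedField : Set₂ where
  infix 4 _<_
  field
    commutativeRing : CommutativeRing 0ℓ 0ℓ

  open CommutativeRing commutativeRing public renaming (Carrier to ℝ)
  open AlgebraDefinitions _≈_ public using (Invertible)

  field
    _<_                : Rel ℝ 0ℓ
    isStrictTotalOrder : IsStrictTotalOrder _≈_ _<_

  open ToNonStrict _≈_ _<_ public using (_≤_)
  open Order _≤_ public

  field
    0≉1         : ¬ (0# ≈ 1#)
    invertible  : ∀ x → ¬ (x ≈ 0#) → Invertible 1# _*_ x
    +-monoˡ-<   : ∀ z {x y} → x < y → x + z < y + z
    *-pos       : ∀ {x y} → 0# < x → 0# < y → 0# < x * y
    completeness : (X : Pred ℝ (Level.suc 0ℓ)) → ∃ X → ∃ (UpperBound X) →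
                   ∃ (IsSupremum X)

module Reals (R : CompleteOrderedField) where

  open CompleteOrderedField R public
  open IsStrictTotalOrder isStrictTotalOrder public
    using (compare; irrefl; <-respˡ-≈; <-respʳ-≈)
    renaming (trans to <-trans)
  open IsTotalOrder (ToNonStrict.isTotalOrder _≈_ _<_ isStrictTotalOrder) public
    using () renaming (refl to ≤-refl; reflexive to ≤-reflexive; trans to ≤-trans)
  open MonoidSum +-monoid public using (sum; sum-replicate-zero; sum-cong-≋)

  infix 4 _>_
  _>_ : Rel ℝ 0ℓ
  x > y = y < x

  _≥_ : Rel ℝ 0ℓ
  x ≥ y = y ≤ x

  divide : ∀ x y → ¬ (y ≈ 0#) → ℝ
  divide x y y≉0 = x * proj₁ (invertible y y≉0)

  x>y⇒x-y≉0 : ∀ {x y} → x > y → ¬ (x - y ≈ 0#)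
  x>y⇒x-y≉0 {x} {y} x>y x-y≈0 =
    irrefl (sym (GroupProperties.x∙y⁻¹≈ε⇒x≈y +-group x y x-y≈0)) x>y

  -- |x - y| < ε
  _Within_Of_ : ℝ → ℝ → ℝ → Set
  x Within ε Of y = x - y < ε × y - x < ε

  ContinuousOn : (D : Pred ℝ 0ℓ) → (∀ x → D x → ℝ) → Set
  ContinuousOn D f =
    ∀ x (x∈D : D x) ε → ε > 0# →
    ∃[ δ ] δ > 0# × (∀ y (y∈D : D y) → y Within δ Of x →
                     f y y∈D Within ε Of f x x∈D)

  -- Sum of a series of nonnegative terms.
  SeriesSum : (ℕ → ℝ) → ℝ → Set
  SeriesSum a = IsSupremum (λ s → ∃[ n ] s ≈ sum {n} (λ i → a (toℕ i)))

  record PlaneSet : Set₁ where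
    field
      Member : Pred (ℝ × ℝ) 0ℓ
      resp   : Member Respects (Pointwise _≈_ _≈_)

  open PlaneSet public

  infix 4 _∈_
  _∈_ : ℝ × ℝ → PlaneSet → Set
  p ∈ S = Member S p

  XCoords YCoords : PlaneSet → Setoid 0ℓ 0ℓ
  XCoords S = On.setoid {B = ∃[ x ] ∃[ y ] (x , y) ∈ S} setoid proj₁
  YCoords S = On.setoid {B = ∃[ y ] ∃[ x ] (x , y) ∈ S} setoid proj₁

  -- A and B stand for the predicates cutting out subsets of ℝ.
  SlopesAtLeastOne : {A B : Pred ℝ 0ℓ} → (∃ A → ∃ B) → Set
  SlopesAtLeastOne {A} f =
    ∀ (a b : ∃ A) → (a>b : proj₁ a > proj₁ b) →
    divide (proj₁ (f a) - proj₁ (f b)) (proj₁ a - proj₁ b) (x>y⇒x-y≉0 a>b) ≥ 1#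

  _Contains_ : PlaneSet → PlaneSet → Set
  S Contains P =
    Σ (Func (XCoords P) (XCoords S)) λ f →
    Σ (Func (YCoords P) (YCoords S)) λ g →
    SlopesAtLeastOne (Func.to f) ×
    SlopesAtLeastOne (Func.to g) ×
    (∀ x y (p : (x , y) ∈ P) →
      (proj₁ (Func.to f (x , y , p)) , proj₁ (Func.to g (y , x , p))) ∈ S)

  _IsFreeOf_ : PlaneSet → PlaneSet → Set
  S IsFreeOf P = ¬ (S Contains P)

  IsOpen : PlaneSet → Set
  IsOpen S = ∀ x y → (x , y) ∈ S →
    ∃[ ε ] ε > 0# × (∀ x′ y′ → x′ Within ε Of x → y′ Within ε Of y →
                     (x′ , y′) ∈ S)

  -- S ⊆ [0,n]²
  InSquare : ℝ → PlaneSet → Set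
  InSquare n S = ∀ x y → (x , y) ∈ S → (0# ≤ x × x ≤ n) × (0# ≤ y × y ≤ n)

  -- The open box (a , b) × (c , d), possibly empty.
  record Box : Set where
    field
      a b c d : ℝ
      a≤b     : a ≤ b
      c≤d     : c ≤ d

  area : Box → ℝ
  area B = (b - a) * (d - c) where open Box B

  _∈Box_ : ℝ × ℝ → Box → Set
  (x , y) ∈Box B = (a < x × x < b) × (c < y × y < d) where open Box B

  Covers : (ℕ → Box) → PlaneSet → Set
  Covers B S = ∀ x y → (x , y) ∈ S → ∃[ i ] (x , y) ∈Box B i

  CoverTotal : PlaneSet → Pred ℝ 0ℓ
  CoverTotal S t = ∃[ B ] Covers B S × SeriesSum (λ i → area (B i)) t

  -- "v is the Lebesgue (outer) measure of S".  A relation, because a set of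
  -- infinite measure has no such v; it is applied below only to bounded open
  -- sets, which are measurable and of finite measure.
  IsLebesgueMeasure : PlaneSet → ℝ → Set
  IsLebesgueMeasure S = IsInfimum (CoverTotal S)

  FreeMeasure : ℝ → PlaneSet → Pred ℝ (Level.suc 0ℓ)
  FreeMeasure n P v =
    Σ PlaneSet λ S → IsOpen S × S IsFreeOf P × InSquare n S × IsLebesgueMeasure S v

  -- The supremum is taken in [0,∞), so that sup ∅ = 0.  The added 0 matters
  -- only for empty P, which every set contains; otherwise the empty set is
  -- P-free of measure 0.
  OpxValues : ℝ → PlaneSet → Pred ℝ (Level.suc 0ℓ)
  OpxValues n P = (_≈ 0#) ∪ FreeMeasure n P

  0<1 : 0# < 1#
  0<1 with compare 0# 1#
  ... | tri< p _ _ = p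
  ... | tri≈ _ p _ = contradiction p 0≉1
  ... | tri> _ _ 1<0 = <-respʳ-≈ -1*-1≈1 (*-pos 0<-1 0<-1)
    where
    open RingProperties ring
    0<-1 : 0# < - 1#
    0<-1 = <-respˡ-≈ (-‿inverseʳ 1#) (<-respʳ-≈ (+-identityˡ (- 1#)) (+-monoˡ-< (- 1#) 1<0))
    -1*-1≈1 : - 1# * - 1# ≈ 1#
    -1*-1≈1 = trans (-1*x≈-x (- 1#)) (⁻¹-involutive 1#)
      where open GroupProperties +-group

  x<x+1 : ∀ x → x < x + 1#
  x<x+1 x = <-respˡ-≈ (+-identityˡ x) (<-respʳ-≈ (+-comm 1# x) (+-monoˡ-< x 0<1))

  -1<0 : - 1# < 0#
  -1<0 = <-respˡ-≈ (+-identityˡ (- 1#)) (<-respʳ-≈ (-‿inverseʳ 1#) (+-monoˡ-< (- 1#) 0<1))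

  <-≤-trans : ∀ {x y z} → x < y → y ≤ z → x < z
  <-≤-trans = ToNonStrict.<-≤-trans _≈_ _<_ <-trans <-respʳ-≈

  ≤-<-trans : ∀ {x y z} → x ≤ y → y < z → x < z
  ≤-<-trans = ToNonStrict.≤-<-trans _≈_ _<_ sym <-trans <-respˡ-≈

  module Bound (n : ℝ) (n>0 : n > 0#) where

    -1<n+1 : - 1# < n + 1#
    -1<n+1 = <-trans -1<0 (<-trans n>0 (x<x+1 n))

    outer : Box
    outer = record
      { a = - 1# ; b = n + 1# ; c = - 1# ; d = n + 1#
      ; a≤b = inj₁ -1<n+1 ; c≤d = inj₁ -1<n+1 }

    null : Box
    null = record
      { a = 0# ; b = 0# ; c = 0# ; d = 0# ; a≤b = ≤-refl ; c≤d = ≤-refl }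

    cover : ℕ → Box
    cover zero    = outer
    cover (suc _) = null

    covers : ∀ S → InSquare n S → Covers cover S
    covers S S⊆ x y s with S⊆ x y s
    ... | (0≤x , x≤n) , (0≤y , y≤n) =
      0 , (<-≤-trans -1<0 0≤x , ≤-<-trans x≤n (x<x+1 n))
        , (<-≤-trans -1<0 0≤y , ≤-<-trans y≤n (x<x+1 n))

    area-null : area null ≈ 0#
    area-null = trans (*-congʳ (-‿inverseʳ 0#)) (zeroˡ _)

    area-outer>0 : 0# < area outer
    area-outer>0 = *-pos side>0 side>0
      where
      side>0 : 0# < (n + 1#) - (- 1#)
      side>0 = <-respˡ-≈ (-‿inverseʳ (- 1#)) (+-monoˡ-< (- (- 1#)) -1<n+1)

    partial-suc : ∀ k → sum {suc k} (λ i → area (cover (toℕ i))) ≈ area outer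
    partial-suc k = trans
      (+-congˡ (trans (sum-cong-≋ {k} (λ _ → area-null)) (sum-replicate-zero k)))
      (+-identityʳ (area outer))

    total : SeriesSum (λ i → area (cover i)) (area outer)
    total = upper , λ u ub → ub (1 , sym (partial-suc 0))
      where
      upper : UpperBound (λ s → ∃[ k ] s ≈ sum {k} (λ i → area (cover (toℕ i))))
                         (area outer)
      upper (zero  , s≈) = ≤-trans (≤-reflexive s≈) (inj₁ area-outer>0)
      upper (suc k , s≈) = ≤-reflexive (trans s≈ (partial-suc k))

    bounded : ∀ P → UpperBound (OpxValues n P) (area outer)
    bounded P (inj₁ v≈0) = ≤-trans (≤-reflexive v≈0) (inj₁ area-outer>0)
    bounded P (inj₂ (S , _ , _ , S⊆ , lb , _)) = lb (cover , covers S S⊆ , total)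

  opx : PlaneSet → (n : ℝ) → n > 0# → ℝ
  opx P n n>0 = proj₁ (completeness (OpxValues n P) (0# , inj₁ refl)
                        (_ , Bound.bounded n n>0 P))

{-# OPTIONS --safe #-}

-- If a contraction of the plane contains P, then so does the original set,
-- because the dilation back only increases slopes.  Hence contracting a P-free
-- subset of [0,n]² onto [0,m]², m ≤ n, gives a P-free set of measure scaled by
-- (m/n)², so m² opx(n) ≤ n² opx(m).  Together with monotonicity,
-- (m/n)² opx(n) ≤ opx(m) ≤ opx(n), which forces continuity.

module Submission where

open import Defs
open import Data.Fin.Base using (toℕ)
open import Data.Nat.Base using (ℕ)
open import Data.Product.Base using (∃-syntax; _×_; _,_; proj₁; proj₂)
open import Data.Sum.Base using (inj₁; inj₂)
open import Function.Bundles using (Func)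
open import Relation.Binary.Bundles using (StrictPartialOrder)
open import Relation.Binary.Definitions using (tri<; tri≈; tri>)
open import Relation.Binary.Structures using (IsStrictTotalOrder)
open import Relation.Nullary.Negation.Core using (contradiction)
import Algebra.Properties.Group as GroupProperties
import Algebra.Properties.Ring as RingProperties
import Algebra.Properties.Semiring.Sum as SemiringSum
import Algebra.Solver.Ring.NaturalCoefficients.Default as SemiringSolver
import Relation.Binary.Reasoning.StrictPartialOrder as StrictReasoning

-- Ordered field arithmetic, reciprocals and scaled series.

module OrderedField (R : CompleteOrderedField) where

  open Reals R
  open RingProperties ring using (x[y-z]≈xy-xz)
  open GroupProperties +-group using (//-rightDividesˡ)
  open SemiringSum semiring using (*-distribˡ-sum)
  open SemiringSolver commutativeSemiring using (solve; _:=_; _:+_; _:*_)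

  strictPartialOrder : StrictPartialOrder _ _ _
  strictPartialOrder = record
    { isStrictPartialOrder = IsStrictTotalOrder.isStrictPartialOrder isStrictTotalOrder }

  open StrictReasoning strictPartialOrder

  +-monoʳ-< : ∀ z {x y} → x < y → z + x < z + y
  +-monoʳ-< z {x} {y} x<y = begin-strict
    z + x ≈⟨ +-comm z x ⟩
    x + z <⟨ +-monoˡ-< z x<y ⟩
    y + z ≈⟨ +-comm y z ⟩
    z + y ∎

  +-monoˡ-≤ : ∀ z {x y} → x ≤ y → x + z ≤ y + z
  +-monoˡ-≤ z (inj₁ x<y) = inj₁ (+-monoˡ-< z x<y)
  +-monoˡ-≤ z (inj₂ x≈y) = inj₂ (+-congʳ x≈y)

  +-monoʳ-≤ : ∀ z {x y} → x ≤ y → z + x ≤ z + y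
  +-monoʳ-≤ z (inj₁ x<y) = inj₁ (+-monoʳ-< z x<y)
  +-monoʳ-≤ z (inj₂ x≈y) = inj₂ (+-congˡ x≈y)

  +-mono-≤ : ∀ {x y u v} → x ≤ y → u ≤ v → x + u ≤ y + v
  +-mono-≤ {y = y} {u} x≤y u≤v = ≤-trans (+-monoˡ-≤ u x≤y) (+-monoʳ-≤ y u≤v)

  x-y+y≈x : ∀ x y → (x - y) + y ≈ x
  x-y+y≈x x y = //-rightDividesˡ y x

  x<y+z⇒x-y<z : ∀ {x y z} → x < y + z → x - y < z
  x<y+z⇒x-y<z {x} {y} {z} x<y+z = begin-strict
    x - y           <⟨ +-monoˡ-< (- y) x<y+z ⟩
    (y + z) - y     ≈⟨ +-congʳ (+-comm y z) ⟩
    (z + y) - y     ≈⟨ GroupProperties.//-rightDividesʳ +-group y z ⟩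
    z ∎

  x-y<z⇒x<y+z : ∀ {x y z} → x - y < z → x < y + z
  x-y<z⇒x<y+z {x} {y} {z} x-y<z = begin-strict
    x           ≈⟨ sym (x-y+y≈x x y) ⟩
    (x - y) + y <⟨ +-monoˡ-< y x-y<z ⟩
    z + y       ≈⟨ +-comm z y ⟩
    y + z       ∎

  x<y⇒0<y-x : ∀ {x y} → x < y → 0# < y - x
  x<y⇒0<y-x {x} {y} x<y = begin-strict
    0#    ≈⟨ sym (-‿inverseʳ x) ⟩
    x - x <⟨ +-monoˡ-< (- x) x<y ⟩
    y - x ∎

  *-monoˡ-< : ∀ {z x y} → 0# < z → x < y → z * x < z * y
  *-monoˡ-< {z} {x} {y} 0<z x<y = begin-strict
    z * x                 ≈⟨ sym (+-identityˡ (z * x)) ⟩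
    0# + z * x            <⟨ +-monoˡ-< (z * x) (*-pos 0<z (x<y⇒0<y-x x<y)) ⟩
    z * (y - x) + z * x   ≈⟨ sym (distribˡ z (y - x) x) ⟩
    z * ((y - x) + x)     ≈⟨ *-congˡ (x-y+y≈x y x) ⟩
    z * y                 ∎

  *-monoˡ-≤ : ∀ {z x y} → 0# ≤ z → x ≤ y → z * x ≤ z * y
  *-monoˡ-≤ (inj₁ 0<z) (inj₁ x<y) = inj₁ (*-monoˡ-< 0<z x<y)
  *-monoˡ-≤ {z} {x} {y} (inj₂ 0≈z) (inj₁ x<y) = begin
    z * x  ≈⟨ *-congʳ (sym 0≈z) ⟩
    0# * x ≈⟨ trans (zeroˡ x) (sym (zeroˡ y)) ⟩
    0# * y ≈⟨ *-congʳ 0≈z ⟩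
    z * y  ∎
  *-monoˡ-≤ _ (inj₂ x≈y) = inj₂ (*-congˡ x≈y)

  *-monoʳ-≤ : ∀ {z x y} → 0# ≤ z → x ≤ y → x * z ≤ y * z
  *-monoʳ-≤ {z} {x} {y} 0≤z x≤y = begin
    x * z ≈⟨ *-comm x z ⟩
    z * x ≤⟨ *-monoˡ-≤ 0≤z x≤y ⟩
    z * y ≈⟨ *-comm z y ⟩
    y * z ∎

  *-nonNeg : ∀ {x y} → 0# ≤ x → 0# ≤ y → 0# ≤ x * y
  *-nonNeg {x} {y} 0≤x 0≤y = begin
    0#     ≈⟨ sym (zeroʳ x) ⟩
    x * 0# ≤⟨ *-monoˡ-≤ 0≤x 0≤y ⟩
    x * y  ∎

  +-pos-nonNeg : ∀ {x y} → 0# < x → 0# ≤ y → 0# < x + y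
  +-pos-nonNeg {x} {y} 0<x 0≤y = begin-strict
    0#     <⟨ 0<x ⟩
    x      ≈⟨ sym (+-identityʳ x) ⟩
    x + 0# ≤⟨ +-monoʳ-≤ x 0≤y ⟩
    x + y  ∎

  *-cancelˡ-< : ∀ {z x y} → 0# < z → z * x < z * y → x < y
  *-cancelˡ-< {z} {x} {y} 0<z zx<zy with compare x y
  ... | tri< x<y _ _ = x<y
  ... | tri≈ _ x≈y _ = contradiction zx<zy (irrefl (*-congˡ x≈y))
  ... | tri> _ _ y<x = contradiction (<-trans zx<zy (*-monoˡ-< 0<z y<x)) (irrefl refl)

  -- A scaling factor is carried together with its inverse and both signs. The data are symmetric,
  -- so `flip` turns every lemma about dilating by `c` into one about contracting by it.
  record Reciprocal (c c⁻¹ : ℝ) : Set where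
    field
      c>0     : 0# < c
      c⁻¹>0   : 0# < c⁻¹
      inverse : c * c⁻¹ ≈ 1#

  open Reciprocal

  private variable c c⁻¹ d d⁻¹ : ℝ

  flip : Reciprocal c c⁻¹ → Reciprocal c⁻¹ c
  flip r = record
    { c>0 = c⁻¹>0 r ; c⁻¹>0 = c>0 r ; inverse = trans (*-comm _ _) (inverse r) }

  _⊛_ : Reciprocal c c⁻¹ → Reciprocal d d⁻¹ → Reciprocal (c * d) (c⁻¹ * d⁻¹)
  _⊛_ {c} {c⁻¹} {d} {d⁻¹} r s = record
    { c>0     = *-pos (c>0 r) (c>0 s)
    ; c⁻¹>0   = *-pos (c⁻¹>0 r) (c⁻¹>0 s)
    ; inverse = begin-equality
        (c * d) * (c⁻¹ * d⁻¹)
          ≈⟨ solve 4 (λ a b x y → (a :* b) :* (x :* y) := (a :* x) :* (b :* y)) refl c d c⁻¹ d⁻¹ ⟩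
        (c * c⁻¹) * (d * d⁻¹) ≈⟨ *-cong (inverse r) (inverse s) ⟩
        1# * 1#               ≈⟨ *-identityˡ 1# ⟩
        1#                    ∎
    }

  reciprocal : ∀ {x} → 0# < x → ∃[ x⁻¹ ] Reciprocal x x⁻¹
  reciprocal {x} 0<x = x⁻¹ , record { c>0 = 0<x ; c⁻¹>0 = 0<x⁻¹ ; inverse = xx⁻¹≈1 }
    where
    x-invertible = invertible x λ x≈0 → irrefl (sym x≈0) 0<x
    x⁻¹ = proj₁ x-invertible
    xx⁻¹≈1 = proj₂ (proj₂ x-invertible)

    0<x⁻¹ : 0# < x⁻¹
    0<x⁻¹ = *-cancelˡ-< 0<x (begin-strict
      x * 0#  ≈⟨ zeroʳ x ⟩
      0#      <⟨ 0<1 ⟩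
      1#      ≈⟨ sym xx⁻¹≈1 ⟩
      x * x⁻¹ ∎)

  c⁻¹cx≈x : Reciprocal c c⁻¹ → ∀ x → c⁻¹ * (c * x) ≈ x
  c⁻¹cx≈x {c} {c⁻¹} r x = begin-equality
    c⁻¹ * (c * x) ≈⟨ sym (*-assoc c⁻¹ c x) ⟩
    (c⁻¹ * c) * x ≈⟨ *-congʳ (inverse (flip r)) ⟩
    1# * x        ≈⟨ *-identityˡ x ⟩
    x             ∎

  cx≤y⇒x≤c⁻¹y : Reciprocal c c⁻¹ → ∀ {x y} → c * x ≤ y → x ≤ c⁻¹ * y
  cx≤y⇒x≤c⁻¹y {c} {c⁻¹} r {x} {y} cx≤y = begin
    x             ≈⟨ sym (c⁻¹cx≈x r x) ⟩
    c⁻¹ * (c * x) ≤⟨ *-monoˡ-≤ (inj₁ (c⁻¹>0 r)) cx≤y ⟩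
    c⁻¹ * y       ∎

  x≤cy⇒c⁻¹x≤y : Reciprocal c c⁻¹ → ∀ {x y} → x ≤ c * y → c⁻¹ * x ≤ y
  x≤cy⇒c⁻¹x≤y {c} {c⁻¹} r {x} {y} x≤cy = begin
    c⁻¹ * x       ≤⟨ *-monoˡ-≤ (inj₁ (c⁻¹>0 r)) x≤cy ⟩
    c⁻¹ * (c * y) ≈⟨ c⁻¹cx≈x r y ⟩
    y             ∎

  -- Multiplication by a positive `c` is an order isomorphism, so it carries suprema of partial sums
  -- to suprema: an upper bound `u` of the scaled partial sums gives the bound `c⁻¹ * u` for the
  -- original ones. The terms `b` are separate from `c * a` because areas of scaled boxes agree with
  -- scaled areas only up to `≈`.
  *-distribˡ-seriesSum : Reciprocal c c⁻¹ → (a b : ℕ → ℝ) → (∀ i → b i ≈ c * a i) →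
                         ∀ {t} → SeriesSum a t → SeriesSum b (c * t)
  *-distribˡ-seriesSum {c} r a b b≈ca {t} (upper , least) = upper′ , least′
    where
    partial : ∀ k → sum {k} (λ i → b (toℕ i)) ≈ c * sum {k} (λ i → a (toℕ i))
    partial k = trans (sum-cong-≋ {k} λ i → b≈ca (toℕ i))
                      (sym (*-distribˡ-sum {k} c (λ i → a (toℕ i))))

    upper′ : UpperBound (λ s → ∃[ k ] s ≈ sum {k} (λ i → b (toℕ i))) (c * t)
    upper′ (k , s≈) = ≤-trans (≤-reflexive (trans s≈ (partial k)))
                              (*-monoˡ-≤ (inj₁ (c>0 r)) (upper (k , refl)))

    least′ : ∀ u → UpperBound (λ s → ∃[ k ] s ≈ sum {k} (λ i → b (toℕ i))) u → c * t ≤ u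
    least′ u ub = x≤cy⇒c⁻¹x≤y (flip r) (least _ λ where
      (k , s≈) → cx≤y⇒x≤c⁻¹y r
        (≤-trans (≤-reflexive (trans (*-congˡ s≈) (sym (partial k)))) (ub (k , refl))))

  -- The error term 3xδG is what δ is chosen to absorb.
  square-growth : ∀ {x m M δ G} → 0# ≤ G → 0# ≤ δ → 0# ≤ M → m ≤ x → 0# ≤ m → δ ≤ x → M ≤ m + δ →
                  (M * M) * G ≤ (m * m) * G + x * (δ * (G + G + G))
  square-growth {x} {m} {M} {δ} {G} 0≤G 0≤δ 0≤M m≤x 0≤m δ≤x M≤m+δ = begin
    (M * M) * G
      ≤⟨ *-monoʳ-≤ 0≤G (≤-trans (*-monoˡ-≤ 0≤M M≤m+δ) (*-monoʳ-≤ (≤-trans 0≤M M≤m+δ) M≤m+δ)) ⟩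
    ((m + δ) * (m + δ)) * G
      ≈⟨ solve 3 (λ m δ G → ((m :+ δ) :* (m :+ δ)) :* G
                         := (m :* m) :* G :+ (m :+ m :+ δ) :* (δ :* G)) refl m δ G ⟩
    (m * m) * G + (m + m + δ) * (δ * G)
      ≤⟨ +-monoʳ-≤ _ (*-monoʳ-≤ (*-nonNeg 0≤δ 0≤G) (+-mono-≤ (+-mono-≤ m≤x m≤x) δ≤x)) ⟩
    (m * m) * G + (x + x + x) * (δ * G)
      ≈⟨ +-congˡ (solve 3 (λ x δ G → (x :+ x :+ x) :* (δ :* G)
                                  := x :* (δ :* (G :+ G :+ G))) refl x δ G) ⟩
    (m * m) * G + x * (δ * (G + G + G)) ∎

  -- The choice of δ for a given ε.

  module Modulus {x ε G : ℝ} (x>0 : 0# < x) (ε>0 : 0# < ε) (G≥0 : 0# ≤ G) where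

    3G≥0 : 0# ≤ G + G + G
    3G≥0 = ≤-trans (≤-reflexive (sym (trans (+-identityʳ _) (+-identityʳ 0#))))
                   (+-mono-≤ (+-mono-≤ G≥0 G≥0) G≥0)

    denominator : ∃[ q⁻¹ ] Reciprocal (ε + (G + G + G)) q⁻¹
    denominator = reciprocal (+-pos-nonNeg ε>0 3G≥0)

    -- This is xε / (ε + 3G). The summand ε keeps the denominator positive when G = 0 and makes the
    -- inequality 3Gδ < xε strict.
    δ : ℝ
    δ = proj₁ denominator * (x * ε)

    δ>0 : 0# < δ
    δ>0 = *-pos (c⁻¹>0 (proj₂ denominator)) (*-pos x>0 ε>0)

    δ-equation : δ * ε + δ * (G + G + G) ≈ x * ε
    δ-equation = trans (sym (distribˡ δ ε _))
      (trans (*-comm δ _) (c⁻¹cx≈x (flip (proj₂ denominator)) (x * ε)))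

    -- Holds because xε ≤ x(ε + 3G). It is what lets `square-growth` bound m + m + δ by 3x.
    δ≤x : δ ≤ x
    δ≤x = x≤cy⇒c⁻¹x≤y (proj₂ denominator) (begin
      x * ε               ≤⟨ *-monoˡ-≤ (inj₁ x>0) ε≤q ⟩
      x * (ε + (G + G + G)) ≈⟨ *-comm x _ ⟩
      (ε + (G + G + G)) * x ∎)
      where
      ε≤q : ε ≤ ε + (G + G + G)
      ε≤q = ≤-trans (≤-reflexive (sym (+-identityʳ ε))) (+-monoʳ-≤ ε 3G≥0)

    -- The error 3xδG is smaller than x²ε, so it is absorbed into x²(B + ε), after which x² cancels.
    close : ∀ {A B} → (x * x) * A ≤ (x * x) * B + x * (δ * (G + G + G)) → A < B + ε
    close {A} {B} h = *-cancelˡ-< (*-pos x>0 x>0) (begin-strict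
      (x * x) * A                              ≤⟨ h ⟩
      (x * x) * B + x * (δ * (G + G + G))      <⟨ +-monoʳ-< _ (*-monoˡ-< x>0 3δG<xε) ⟩
      (x * x) * B + x * (x * ε)
        ≈⟨ solve 3 (λ x B ε → (x :* x) :* B :+ x :* (x :* ε) := (x :* x) :* (B :+ ε)) refl x B ε ⟩
      (x * x) * (B + ε)                        ∎)
      where
      3δG<xε : δ * (G + G + G) < x * ε
      3δG<xε = begin-strict
        δ * (G + G + G)          ≈⟨ sym (+-identityˡ _) ⟩
        0# + δ * (G + G + G)     <⟨ +-monoˡ-< _ (*-pos δ>0 ε>0) ⟩
        δ * ε + δ * (G + G + G)  ≈⟨ δ-equation ⟩
        x * ε                    ∎

  within-scale : Reciprocal c c⁻¹ → ∀ {x y ε} → x Within c⁻¹ * ε Of y → (c * x) Within ε Of (c * y)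
  within-scale {c} {c⁻¹} r (lo , hi) = half lo , half hi
    where
    half : ∀ {x y ε} → x - y < c⁻¹ * ε → c * x - c * y < ε
    half {x} {y} {ε} x-y<c⁻¹ε = begin-strict
      c * x - c * y   ≈⟨ sym (x[y-z]≈xy-xz c x y) ⟩
      c * (x - y)     <⟨ *-monoˡ-< (c>0 r) x-y<c⁻¹ε ⟩
      c * (c⁻¹ * ε)   ≈⟨ c⁻¹cx≈x (flip r) ε ⟩
      ε               ∎

-- Contractions of plane sets.

module Contraction (R : CompleteOrderedField) where

  open Reals R
  open OrderedField R
  open Reciprocal
  open RingProperties ring using (x[y-z]≈xy-xz)
  open SemiringSolver commutativeSemiring using (solve; _:=_; _:*_)
  open StrictReasoning strictPartialOrder

  private variable
    c c⁻¹ m n t v : ℝ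
    P S T : PlaneSet

  -- The contraction by 1/c is encoded as the preimage under dilation by `c`, so membership involves
  -- no division.
  _⁻¹∙_ : ℝ → PlaneSet → PlaneSet
  c ⁻¹∙ S = record
    { Member = λ (x , y) → (c * x , c * y) ∈ S
    ; resp   = λ (x≈ , y≈) → resp S (*-congˡ x≈ , *-congˡ y≈) }

  -- Covers and Lebesgue measure under scaling.

  scaleBox : Reciprocal c c⁻¹ → Box → Box
  scaleBox {c} r B = record
    { a = c * a ; b = c * b ; c = c * Box.c B ; d = c * d
    ; a≤b = *-monoˡ-≤ (inj₁ (c>0 r)) a≤b ; c≤d = *-monoˡ-≤ (inj₁ (c>0 r)) c≤d }
    where open Box B hiding (c)

  area-scaleBox : (r : Reciprocal c c⁻¹) → ∀ B → area (scaleBox r B) ≈ (c * c) * area B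
  area-scaleBox {c} r B = begin-equality
    (c * b - c * a) * (c * d - c * Box.c B)
      ≈⟨ *-cong (sym (x[y-z]≈xy-xz c b a)) (sym (x[y-z]≈xy-xz c d (Box.c B))) ⟩
    (c * (b - a)) * (c * (d - Box.c B))
      ≈⟨ solve 3 (λ c x y → (c :* x) :* (c :* y) := (c :* c) :* (x :* y)) refl c (b - a) (d - Box.c B) ⟩
    (c * c) * area B ∎
    where open Box B hiding (c)

  ∈-scaleBox : (r : Reciprocal c c⁻¹) → ∀ B {x y} →
               (c⁻¹ * x , c⁻¹ * y) ∈Box B → (x , y) ∈Box scaleBox r B
  ∈-scaleBox {c} {c⁻¹} r B ((a<x , x<b) , (c<y , y<d)) =
    (lower a<x , upper x<b) , (lower c<y , upper y<d)
    where
    lower : ∀ {e x} → e < c⁻¹ * x → c * e < x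
    lower e<c⁻¹x = <-respʳ-≈ (c⁻¹cx≈x (flip r) _) (*-monoˡ-< (c>0 r) e<c⁻¹x)
    upper : ∀ {e x} → c⁻¹ * x < e → x < c * e
    upper c⁻¹x<e = <-respˡ-≈ (c⁻¹cx≈x (flip r) _) (*-monoˡ-< (c>0 r) c⁻¹x<e)

  -- The inclusion T ⊆ cS is expressed through `c⁻¹`. Scaling every box of a cover of `S` then
  -- covers `T`, and each area picks up the factor c².
  coverTotal-scale : Reciprocal c c⁻¹ → (∀ x y → (x , y) ∈ T → (c⁻¹ * x , c⁻¹ * y) ∈ S) →
                     CoverTotal S t → CoverTotal T ((c * c) * t)
  coverTotal-scale r T⊆cS (B , covers , total) =
    (λ i → scaleBox r (B i)) ,
    (λ x y xy∈T → let i , xy∈B = covers _ _ (T⊆cS x y xy∈T) in i , ∈-scaleBox r (B i) xy∈B) ,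
    *-distribˡ-seriesSum (r ⊛ r) (λ i → area (B i)) _ (λ i → area-scaleBox r (B i)) total

  -- Covers can be scaled in both directions, so the infima of their totals correspond: dilated
  -- covers of the contraction give the lower bound, contracted covers of `S` show that it is
  -- greatest.
  measure-contract : Reciprocal c c⁻¹ → IsLebesgueMeasure S v →
                     IsLebesgueMeasure (c ⁻¹∙ S) ((c⁻¹ * c⁻¹) * v)
  measure-contract {c} {c⁻¹} {S} {v} r (lower , greatest) = lower′ , greatest′
    where
    lower′ : LowerBound (CoverTotal (c ⁻¹∙ S)) ((c⁻¹ * c⁻¹) * v)
    lower′ total = x≤cy⇒c⁻¹x≤y (r ⊛ r) (lower (coverTotal-scale {T = S} {S = c ⁻¹∙ S} r
      (λ x y → resp S (sym (c⁻¹cx≈x (flip r) x) , sym (c⁻¹cx≈x (flip r) y))) total))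

    greatest′ : ∀ l → LowerBound (CoverTotal (c ⁻¹∙ S)) l → l ≤ (c⁻¹ * c⁻¹) * v
    greatest′ l lb = cx≤y⇒x≤c⁻¹y (r ⊛ r) (greatest _ λ total →
      x≤cy⇒c⁻¹x≤y (flip (r ⊛ r))
        (lb (coverTotal-scale {T = c ⁻¹∙ S} {S = S} (flip r) (λ _ _ xy∈ → xy∈) total)))

  -- Openness, squares and containment under contraction.

  isOpen-contract : Reciprocal c c⁻¹ → IsOpen S → IsOpen (c ⁻¹∙ S)
  isOpen-contract r open-S x y xy∈ = let ε , ε>0 , ball⊆S = open-S _ _ xy∈ in
    -- The inferred radius is `c⁻¹ * ε`, which dilation by `c` turns back into `ε`.
    _ , *-pos (c⁻¹>0 r) ε>0 ,
    λ x′ y′ x′≈x y′≈y → ball⊆S _ _ (within-scale r x′≈x) (within-scale r y′≈y)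

  inSquare-contract : Reciprocal c c⁻¹ → n ≈ c * m → InSquare n S → InSquare m (c ⁻¹∙ S)
  inSquare-contract {c} {c⁻¹} {n} {m} r n≈cm S⊆ x y xy∈ =
    let (0≤cx , cx≤n) , (0≤cy , cy≤n) = S⊆ _ _ xy∈
    in (lower 0≤cx , upper cx≤n) , (lower 0≤cy , upper cy≤n)
    where
    lower : ∀ {z} → 0# ≤ c * z → 0# ≤ z
    lower 0≤cz = ≤-trans (≤-reflexive (sym (zeroʳ c⁻¹))) (x≤cy⇒c⁻¹x≤y r 0≤cz)
    upper : ∀ {z} → c * z ≤ n → z ≤ m
    upper cz≤n = ≤-trans (cx≤y⇒x≤c⁻¹y r (≤-trans cz≤n (≤-reflexive n≈cm)))
                         (≤-reflexive (c⁻¹cx≈x r m))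

  -- Here `i` stands for the inverse of the difference of two coordinates of `P`. Only the images
  -- are dilated, so `i` stays fixed while the numerator grows by the factor `c`.
  slope-dilate : ∀ {u w i} → 1# ≤ c → 1# ≤ (u - w) * i → 1# ≤ (c * u - c * w) * i
  slope-dilate {c} {u} {w} {i} 1≤c 1≤slope = begin
    1#                    ≤⟨ 1≤c ⟩
    c                     ≈⟨ sym (*-identityʳ c) ⟩
    c * 1#                ≤⟨ *-monoˡ-≤ (≤-trans (inj₁ 0<1) 1≤c) 1≤slope ⟩
    c * ((u - w) * i)     ≈⟨ sym (*-assoc c (u - w) i) ⟩
    (c * (u - w)) * i     ≈⟨ *-congʳ (x[y-z]≈xy-xz c u w) ⟩
    (c * u - c * w) * i   ∎

  -- Both coordinate maps are followed by multiplication by `c`. By the preimage encoding, the image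
  -- points lie in `S` by definition, so `maps-into` is reused unchanged.
  contains-dilate : 1# ≤ c → (c ⁻¹∙ S) Contains P → S Contains P
  contains-dilate {c} 1≤c (f , g , slope-f , slope-g , maps-into) =
    record { to   = λ p → let x , y , xy∈ = Func.to f p in c * x , c * y , xy∈
           ; cong = λ p≈q → *-congˡ (Func.cong f p≈q) } ,
    record { to   = λ p → let y , x , xy∈ = Func.to g p in c * y , c * x , xy∈
           ; cong = λ p≈q → *-congˡ (Func.cong g p≈q) } ,
    (λ p q p>q → slope-dilate 1≤c (slope-f p q p>q)) ,
    (λ p q p>q → slope-dilate 1≤c (slope-g p q p>q)) ,
    maps-into

  freeMeasure-contract : Reciprocal c c⁻¹ → 1# ≤ c → n ≈ c * m →
                         FreeMeasure n P v → FreeMeasure m P ((c⁻¹ * c⁻¹) * v)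
  freeMeasure-contract {c} {P = P} r 1≤c n≈cm (S , open-S , free , S⊆ , measure) =
    c ⁻¹∙ S , isOpen-contract {S = S} r open-S ,
    (λ contains → free (contains-dilate {S = S} {P = P} 1≤c contains)) ,
    inSquare-contract {S = S} r n≈cm S⊆ , measure-contract {S = S} r measure

-- Bounds on opx and its continuity.

module Continuity (R : CompleteOrderedField) (P : Reals.PlaneSet R) where

  open Reals R
  open OrderedField R
  open Contraction R
  open Reciprocal
  open SemiringSolver commutativeSemiring using (solve; _:=_; _:*_)
  open StrictReasoning strictPartialOrder

  private variable m n v : ℝ

  ≤-opx : (n>0 : n > 0#) → OpxValues n P v → v ≤ opx P n n>0
  ≤-opx n>0 = proj₁ (proj₂ (completeness _ _ (_ , Bound.bounded _ n>0 P)))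

  opx-least : (n>0 : n > 0#) → ∀ u → UpperBound (OpxValues n P) u → opx P n n>0 ≤ u
  opx-least n>0 = proj₂ (proj₂ (completeness _ _ (_ , Bound.bounded _ n>0 P)))

  opx≥0 : (n>0 : n > 0#) → 0# ≤ opx P n n>0
  opx≥0 n>0 = ≤-opx n>0 (inj₁ refl)

  -- A free set inside the smaller square also lies inside the larger one, with the same measure.
  opx-mono : (m>0 : m > 0#) (n>0 : n > 0#) → m ≤ n → opx P m m>0 ≤ opx P n n>0
  opx-mono {m} {n} m>0 n>0 m≤n = opx-least m>0 _ λ where
    (inj₁ v≈0) → ≤-opx n>0 (inj₁ v≈0)
    (inj₂ (S , open-S , free , S⊆ , measure)) → ≤-opx n>0 (inj₂
      (S , open-S , free ,
       (λ x y xy∈ → let (0≤x , x≤m) , (0≤y , y≤m) = S⊆ x y xy∈ in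
         (0≤x , ≤-trans x≤m m≤n) , (0≤y , ≤-trans y≤m m≤n)) ,
       measure))

  -- Division-free form of (m/n)² opx(n) ≤ opx(m). Each free measure v for n contracts to (m/n)² v,
  -- which is at most opx(m), so (n/m)² opx(m) bounds all values for n.
  opx-contract : (m>0 : m > 0#) (n>0 : n > 0#) → m ≤ n →
                 (m * m) * opx P n n>0 ≤ (n * n) * opx P m m>0
  opx-contract {m} {n} m>0 n>0 m≤n = begin
    (m * m) * opx P n n>0
      ≤⟨ *-monoˡ-≤ (inj₁ (*-pos m>0 m>0)) (opx-least n>0 _ bound) ⟩
    (m * m) * ((c * c) * opx P m m>0)
      ≈⟨ solve 3 (λ m c g → (m :* m) :* ((c :* c) :* g) := ((c :* m) :* (c :* m)) :* g)
           refl m c (opx P m m>0) ⟩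
    ((c * m) * (c * m)) * opx P m m>0
      ≈⟨ *-congʳ (*-cong (sym n≈cm) (sym n≈cm)) ⟩
    (n * n) * opx P m m>0 ∎
    where
    1/m = reciprocal m>0
    1/n = reciprocal n>0
    -- The dilation factor n/m, at least 1 since m ≤ n; its inverse in `r` is m/n.
    c = proj₁ 1/m * n

    n≈cm : n ≈ c * m
    n≈cm = trans (sym (c⁻¹cx≈x (proj₂ 1/m) n))
      (solve 3 (λ i m n → i :* (m :* n) := (i :* n) :* m) refl (proj₁ 1/m) m n)

    1≤c : 1# ≤ c
    1≤c = ≤-trans (≤-reflexive (sym (inverse (flip (proj₂ 1/m)))))
                  (*-monoˡ-≤ (inj₁ (c⁻¹>0 (proj₂ 1/m))) m≤n)

    r : Reciprocal c (m * proj₁ 1/n)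
    r = flip (proj₂ 1/m) ⊛ proj₂ 1/n

    bound : UpperBound (OpxValues n P) ((c * c) * opx P m m>0)
    -- The default value 0 does not come from a set, so nonnegativity of `opx` handles it.
    bound (inj₁ v≈0) = ≤-trans (≤-reflexive v≈0)
      (*-nonNeg (inj₁ (c>0 (r ⊛ r))) (opx≥0 m>0))
    bound (inj₂ free) = cx≤y⇒x≤c⁻¹y (flip (r ⊛ r))
      (≤-opx m>0 (inj₂ (freeMeasure-contract {P = P} r 1≤c n≈cm free)))

  opx-continuous : ContinuousOn (λ n → n > 0#) (opx P)
  opx-continuous x x>0 ε ε>0 = δ , δ>0 , near
    where
    open Modulus x>0 ε>0 (opx≥0 x>0)

    G = opx P x x>0

    ≤⇒<+ε : ∀ {A B} → A ≤ B → A < B + ε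
    ≤⇒<+ε {A} {B} A≤B = begin-strict
      A      ≈⟨ sym (+-identityʳ A) ⟩
      A + 0# <⟨ +-monoʳ-< A ε>0 ⟩
      A + ε  ≤⟨ +-monoˡ-≤ ε A≤B ⟩
      B + ε  ∎

    module _ {y} (y>0 : y > 0#) where

      above : x ≤ y → y < x + δ → opx P y y>0 < G + ε
      -- With y² = M² and x² = m², the contraction bound is followed by `square-growth`. The error
      -- involves only the value `G` at `x`, so δ does not depend on `y`.
      above x≤y y<x+δ = close (≤-trans (opx-contract x>0 y>0 x≤y)
        (square-growth (opx≥0 x>0) (inj₁ δ>0) (inj₁ y>0) ≤-refl (inj₁ x>0) δ≤x (inj₁ y<x+δ)))

      below : y ≤ x → x < y + δ → G < opx P y y>0 + ε
      -- The roles swap: x² G is first expanded around y² G, then y² G is contracted to at most x²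
      -- opx(y). The factor to cancel is again x².
      below y≤x x<y+δ = close (≤-trans
        (square-growth (opx≥0 x>0) (inj₁ δ>0) (inj₁ x>0) y≤x (inj₁ y>0) δ≤x (inj₁ x<y+δ))
        (+-monoˡ-≤ _ (opx-contract y>0 x>0 y≤x)))

    near : ∀ y (y>0 : y > 0#) → y Within δ Of x → opx P y y>0 Within ε Of G
    near y y>0 (y-x<δ , x-y<δ) with compare x y
    ... | tri< x<y _ _ =
      x<y+z⇒x-y<z (above y>0 (inj₁ x<y) (x-y<z⇒x<y+z y-x<δ)) ,
      x<y+z⇒x-y<z (≤⇒<+ε (opx-mono x>0 y>0 (inj₁ x<y)))
    -- Monotonicity in both directions stands in for congruence of `opx` under `≈`.
    ... | tri≈ _ x≈y _ =
      x<y+z⇒x-y<z (≤⇒<+ε (opx-mono y>0 x>0 (inj₂ (sym x≈y)))) ,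
      x<y+z⇒x-y<z (≤⇒<+ε (opx-mono x>0 y>0 (inj₂ x≈y)))
    ... | tri> _ _ y<x =
      x<y+z⇒x-y<z (≤⇒<+ε (opx-mono y>0 x>0 (inj₁ y<x))) ,
      x<y+z⇒x-y<z (below y>0 (inj₁ y<x) (x-y<z⇒x<y+z x-y<δ))

proposition2p7 : (R : CompleteOrderedField) → let open Reals R in
    (P : PlaneSet) → ContinuousOn (λ n → n > 0#) (opx P)
proposition2p7 = Continuity.opx-continuous
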